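{- Let $G$ be a deterministic automaton over a finite event set $E$ with uncontrollable events $E_{uc}\subseteq E$, let $d$ be a metric on $E$ with values in $[0,1]$, let $\lambda\in[0,1]$, and let $K\subseteq L(G)$ be a nonempty prefix closed language. Then the Optimal Control Problem (OCP) for $(K,\lambda)$ has a solution if and only if $K$ is $\lambda$-controllable.
   Context: Setting. $E$ is a finite set of events, partitioned as $E=E_c\sqcup E_{uc}$ (controllable / uncontrollable events); $E^*$ is the set of finite strings over $E$ including the empty string $\epsilon$; $l(s)$ is the length of a string $s$; $\overline{L}$ is the prefix closure of a language $L\subseteq E^*$. $G=(Q,E,\delta,q_0)$ is a deterministic automaton with partial transition function $\delta:Q\times E\to Q$, extended to strings as usual, and $L(G)=\{s\in E^*:\delta(q_0,s)\text{ is defined}\}$ (a prefix closed language containing $\epsilon$). Metrics. $d$ is a metric on $E$ with values in $[0,1]$. Set $d(\epsilon,\epsilon)=0$ and $d(a,\epsilon)=d(\epsilon,a)=1$ for $a\in E$. For strings $s=s_1\cdots s_{l(s)}$, $t=t_1\cdots t_{l(t)}$, pad the shorter one with $\epsilon$'s and define $d(s,t)=\sum_{i=1}^{\max\{l(s),l(t)\}}2^{ -i}d(s_i,t_i)$. For a string $s$ and a language $A$, $d(s,A)=\inf_{a\in A}d(s,a)$ if $A\neq\emptyset$ and $d(s,\emptyset)=1$. For languages $A,B$, $d(A,B)$ is the Hausdorff metric: $d(\emptyset,\emptyset)=0$, and otherwise $d(A,B)=\max\{\sup_{a\in A}d(a,B),\sup_{b\in B}d(b,A)\}$ (a supremum over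 the empty set being $0$). Controllability. A language $K\subseteq L(G)$ is controllable if $\overline{K}E_{uc}\cap L(G)\subseteq\overline{K}$. A language $K\subseteq L(G)$ is $\lambda$-controllable if there is a controllable language $\widetilde K\subseteq L(G)$ with $d(\widetilde K,K)\le\lambda$. Supervisors. A supervisor is a map $S:L(G)\to 2^E$ with $S(s)\supseteq E_{uc}$ for all $s\in L(G)$. The language $L(S/G)$ generated by the controlled system is defined recursively by $\epsilon\in L(S/G)$, and $s\sigma\in L(S/G)$ (with $\sigma\in E$) iff $s\in L(S/G)$, $s\sigma\in L(G)$ and $\sigma\in S(s)$. It is a known fact that a nonempty $M\subseteq L(G)$ is controllable iff there is a supervisor $S$ with $L(S/G)=\overline{M}$. OCP for $(K,\lambda)$: find a supervisor $S$ such that (i) $d(L(S/G),K)\le\lambda$, and (ii) $L(S/G)$ is Pareto optimal with respect to $CEM(S)=L(S/G)\cap K$ and $DEM(S)=L(S/G)\setminus K$. Pareto optimality means that any possible enlargement of $CEM(S)$ is necessarily accompanied by an enlargement of $DEM(S)$, and any possible reduction of $DEM(S)$ is necessarily accompanied by a reduction of $CEM(S)$; i.e. there is no supervisor $S'$ with $d(L(S'/G),K)\le\lambda$, $CEM(S')\supseteq CEM(S)$ and $DEM(S')\subseteq DEM(S)$ with at least one of the two inclusions strict. -}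

module Defs where

open import Agda.Primitive using (Setω)
open import Axiom.ExcludedMiddle using (ExcludedMiddle)
open import Data.Empty using (⊥-elim)
open import Data.Fin.Base using (Fin)
open import Data.List.Base using (List; []; _∷_; _++_; _∷ʳ_; length)
open import Data.Maybe using (Maybe; just; nothing; Is-just; _>>=_)
open import Data.Nat.Base as ℕ using (ℕ; zero; suc)
open import Data.Product.Base using (∃; _×_; _,_; proj₁; proj₂)
open import Data.Rational.Base as ℚ using (ℚ; 0ℚ; 1ℚ; ½)
import Data.Integer.Base as ℤ
import Data.Rational.Properties as ℚ
open import Data.Rational.Solver using (module +-*-Solver)
open import Data.Sum.Base using (_⊎_; inj₁; inj₂)
open import Function.Base using (id; _$_)
open import Function.Bundles using (_↔_)
open import Function.Metric.Structures using (IsGeneralMetric)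
open import Level using (0ℓ)
open import Relation.Binary.Definitions using (tri<; tri≈; tri>)
open import Relation.Binary.PropositionalEquality
  using (_≡_; refl; sym; trans; subst)
open import Relation.Nullary.Decidable.Core using (yes; no)
open import Relation.Nullary.Negation.Core using (¬_)
open import Relation.Unary
  using (Pred; _∈_; _⊆_; _⊂_; _≐_; _∩_; _∖_; Satisfiable)

Classical : Setω
Classical = ∀ {ℓ} → ExcludedMiddle ℓ

------------------------------------------------------------------------
-- Real numbers: Dedekind's lower cuts of ℚ. Since the statement is made
-- under excluded middle, the upper half of a cut carries no extra
-- information.

record ℝ : Set₁ where
  field
    Lower     : Pred ℚ 0ℓ
    inhabited : Satisfiable Lower
    bounded   : ∃ λ b → ∀ {q} → q ∈ Lower → q ℚ.< b
    closed    : ∀ {p q} → p ℚ.< q → q ∈ Lower → p ∈ Lower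
    rounded   : ∀ {p} → p ∈ Lower → ∃ λ q → p ℚ.< q × q ∈ Lower

open ℝ public using (Lower)

infix  4 _≤_ _≈_
infixl 6 _+_ _⊔_
infixr 7 ½·_ 2^-_·_

_≤_ : ℝ → ℝ → Set
x ≤ y = Lower x ⊆ Lower y

_≈_ : ℝ → ℝ → Set
x ≈ y = Lower x ≐ Lower y

private
  pred< : ∀ q → q ℚ.- 1ℚ ℚ.< q
  pred< q = subst (q ℚ.- 1ℚ ℚ.<_) (ℚ.+-identityʳ q)
              (ℚ.+-monoʳ-< q {ℚ.- 1ℚ} {0ℚ} (ℚ.*<* (ℤ.-<+)))

  double-½ : ∀ q → ½ ℚ.* q ℚ.+ ½ ℚ.* q ≡ q
  double-½ q = trans (sym (ℚ.*-distribʳ-+ q ½ ½)) (ℚ.*-identityˡ q)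

  halve-< : ∀ {p q} → p ℚ.+ p ℚ.< q ℚ.+ q → p ℚ.< q
  halve-< {p} {q} p+p<q+q with ℚ.<-cmp p q
  ... | tri< p<q _ _ = p<q
  ... | tri≈ _ refl _ = ⊥-elim (ℚ.<-irrefl refl p+p<q+q)
  ... | tri> _ _ q<p = ⊥-elim (ℚ.<-asym p+p<q+q (ℚ.+-mono-< q<p q<p))

fromℚ : ℚ → ℝ
fromℚ q = record
  { Lower     = ℚ._< q
  ; inhabited = q ℚ.- 1ℚ , pred< q
  ; bounded   = q , id
  ; closed    = ℚ.<-trans
  ; rounded   = ℚ.<-dense
  }

0ℝ 1ℝ : ℝ
0ℝ = fromℚ 0ℚ
1ℝ = fromℚ 1ℚ

_+_ : ℝ → ℝ → ℝ
x + y = record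
  { Lower     = Sum
  ; inhabited = let a , a∈x = X.inhabited ; b , b∈y = Y.inhabited in
                a ℚ.+ b , a , b , a∈x , b∈y , refl
  ; bounded   = proj₁ X.bounded ℚ.+ proj₁ Y.bounded , λ where
                  (_ , _ , a∈x , b∈y , refl) →
                    ℚ.+-mono-< (proj₂ X.bounded a∈x) (proj₂ Y.bounded b∈y)
  ; closed    = closed′
  ; rounded   = λ where
                  (_ , b , a∈x , b∈y , refl) →
                    let a′ , a<a′ , a′∈x = X.rounded a∈x in
                    a′ ℚ.+ b , ℚ.+-monoˡ-< b a<a′ , a′ , b , a′∈x , b∈y , refl
  }
  where
  module X = ℝ x
  module Y = ℝ y
  open +-*-Solver
  cancel : ∀ a b → a ℚ.+ b ℚ.- b ≡ a
  cancel = solve 2 (λ a b → (a :+ b) :- b := a) refl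
  restore : ∀ p b → p ℚ.- b ℚ.+ b ≡ p
  restore = solve 2 (λ p b → (p :- b) :+ b := p) refl
  Sum : Pred ℚ 0ℓ
  Sum q = ∃ λ a → ∃ λ b → a ∈ Lower x × b ∈ Lower y × q ≡ a ℚ.+ b
  closed′ : ∀ {p q} → p ℚ.< q → q ∈ Sum → p ∈ Sum
  closed′ {p} p<q (a , b , a∈x , b∈y , refl) =
    p ℚ.- b , b
    , X.closed (subst (p ℚ.- b ℚ.<_) (cancel a b) (ℚ.+-monoˡ-< (ℚ.- b) p<q)) a∈x
    , b∈y , sym (restore p b)

½·_ : ℝ → ℝ
½· x = record
  { Lower     = λ q → q ℚ.+ q ∈ Lower x
  ; inhabited = let q , q∈x = X.inhabited in
                ½ ℚ.* q , subst (_∈ Lower x) (sym (double-½ q)) q∈x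
  ; bounded   = let b , x<b = X.bounded in
                ½ ℚ.* b , λ {q} q+q∈x → halve-< $
                  subst (q ℚ.+ q ℚ.<_) (sym (double-½ b)) (x<b q+q∈x)
  ; closed    = λ p<q → X.closed (ℚ.+-mono-< p<q p<q)
  ; rounded   = λ {p} p+p∈x →
                let r , p+p<r , r∈x = X.rounded p+p∈x in
                ½ ℚ.* r
                , halve-< (subst (p ℚ.+ p ℚ.<_) (sym (double-½ r)) p+p<r)
                , subst (_∈ Lower x) (sym (double-½ r)) r∈x
  }
  where module X = ℝ x

2^-_·_ : ℕ → ℝ → ℝ
2^- zero  · x = x
2^- suc i · x = ½· 2^- i · x

_⊔_ : ℝ → ℝ → ℝ
x ⊔ y = record
  { Lower     = λ q → q ∈ Lower x ⊎ q ∈ Lower y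
  ; inhabited = proj₁ X.inhabited , inj₁ (proj₂ X.inhabited)
  ; bounded   = proj₁ X.bounded ℚ.⊔ proj₁ Y.bounded , λ where
                  (inj₁ q∈x) → ℚ.<-≤-trans (proj₂ X.bounded q∈x)
                                 (ℚ.p≤p⊔q (proj₁ X.bounded) (proj₁ Y.bounded))
                  (inj₂ q∈y) → ℚ.<-≤-trans (proj₂ Y.bounded q∈y)
                                 (ℚ.p≤q⊔p (proj₁ X.bounded) (proj₁ Y.bounded))
  ; closed    = λ where
                  p<q (inj₁ q∈x) → inj₁ (X.closed p<q q∈x)
                  p<q (inj₂ q∈y) → inj₂ (Y.closed p<q q∈y)
  ; rounded   = λ where
                  (inj₁ p∈x) → let q , p<q , q∈x = X.rounded p∈x in q , p<q , inj₁ q∈x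
                  (inj₂ p∈y) → let q , p<q , q∈y = Y.rounded p∈y in q , p<q , inj₂ q∈y
  }
  where
  module X = ℝ x
  module Y = ℝ y

-- Supremum and infimum of a nonempty family with an upper, respectively
-- lower, bound.

sup : {I : Set} (f : I → ℝ) → I → (∃ λ b → ∀ i → f i ≤ b) → ℝ
sup f i₀ (b , f≤b) = record
  { Lower     = λ q → ∃ λ i → q ∈ Lower (f i)
  ; inhabited = let q , q∈f = ℝ.inhabited (f i₀) in q , i₀ , q∈f
  ; bounded   = let c , b<c = ℝ.bounded b in c , λ (i , q∈f) → b<c (f≤b i q∈f)
  ; closed    = λ p<q (i , q∈f) → i , ℝ.closed (f i) p<q q∈f
  ; rounded   = λ (i , p∈f) → let q , p<q , q∈f = ℝ.rounded (f i) p∈f in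
                  q , p<q , i , q∈f
  }

-- The intersection of the cuts may have a greatest element (the family
-- may converge to a rational from above), which is removed.

inf : {I : Set} (f : I → ℝ) → I → (∃ λ b → ∀ i → b ≤ f i) → ℝ
inf f i₀ (b , b≤f) = record
  { Lower     = λ q → ∃ λ r → q ℚ.< r × (∀ i → r ∈ Lower (f i))
  ; inhabited = let r , r∈b = ℝ.inhabited b in
                r ℚ.- 1ℚ , r , pred< r , λ i → b≤f i r∈b
  ; bounded   = let c , f<c = ℝ.bounded (f i₀) in
                c , λ (r , q<r , r∈f) → ℚ.<-trans q<r (f<c (r∈f i₀))
  ; closed    = λ p<q (r , q<r , r∈f) → r , ℚ.<-trans p<q q<r , r∈f
  ; rounded   = λ (r , p<r , r∈f) → let m , p<m , m<r = ℚ.<-dense p<r in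
                  m , p<m , r , m<r , r∈f
  }

-- ∑[ n ] f is f 1 + ⋯ + f n.

∑[_]_ : ℕ → (ℕ → ℝ) → ℝ
∑[ zero  ] f = 0ℝ
∑[ suc n ] f = ∑[ n ] f + f (suc n)

------------------------------------------------------------------------
-- Metrics on events, strings and languages

Finite : Set → Set
Finite E = ∃ λ n → E ↔ Fin n

Language : Set → Set₁
Language E = Pred (List E) 0ℓ

record Metric (E : Set) : Set₁ where
  field
    dist     : E → E → ℝ
    isMetric : IsGeneralMetric _≡_ _≈_ _≤_ 0ℝ _+_ dist
    dist≤1   : ∀ a b → dist a b ≤ 1ℝ

  open IsGeneralMetric isMetric public using (nonNegative)

module Distances (em : Classical) {E : Set} (d : Metric E) where
  open Metric d

  -- The i-th symbol (counting from 1) of a string padded with ε, where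
  -- E ∪ {ε} is represented by Maybe E. Only used at positive indices.

  symbol : List E → ℕ → Maybe E
  symbol []      _             = nothing
  symbol (a ∷ s) zero          = nothing
  symbol (a ∷ s) (suc zero)    = just a
  symbol (a ∷ s) (suc (suc i)) = symbol s (suc i)

  distε : Maybe E → Maybe E → ℝ
  distε nothing  nothing  = 0ℝ
  distε (just a) (just b) = dist a b
  distε (just _) nothing  = 1ℝ
  distε nothing  (just _) = 1ℝ

  distString : List E → List E → ℝ
  distString s t =
    ∑[ length s ℕ.⊔ length t ] λ i → 2^- i · distε (symbol s i) (symbol t i)

  private
    0<1 : 0ℚ ℚ.< 1ℚ
    0<1 = ℚ.positive⁻¹ 1ℚ

    0≤1 : 0ℝ ≤ 1ℝ
    0≤1 q<0 = ℚ.<-trans q<0 0<1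

    0≤distε : ∀ u v → 0ℝ ≤ distε u v
    0≤distε nothing  nothing  = id
    0≤distε (just a) (just b) = nonNegative {a} {b}
    0≤distε (just _) nothing  = 0≤1
    0≤distε nothing  (just _) = 0≤1

    distε≤1 : ∀ u v → distε u v ≤ 1ℝ
    distε≤1 nothing  nothing  = 0≤1
    distε≤1 (just a) (just b) = dist≤1 a b
    distε≤1 (just _) nothing  = id
    distε≤1 nothing  (just _) = id

    0≤2^- : ∀ i {x} → 0ℝ ≤ x → 0ℝ ≤ 2^- i · x
    0≤2^- zero    0≤x = 0≤x
    0≤2^- (suc i) 0≤x q<0 = 0≤2^- i 0≤x (ℚ.+-mono-< q<0 q<0)

    0≤∑ : ∀ n {f} → (∀ i → 0ℝ ≤ f i) → 0ℝ ≤ ∑[ n ] f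
    0≤∑ zero    0≤f = id
    0≤∑ (suc n) 0≤f {q} q<0 =
      ½ ℚ.* q , ½ ℚ.* q , 0≤∑ n 0≤f ½q<0 , 0≤f (suc n) ½q<0 , sym (double-½ q)
      where
      ½q<0 : ½ ℚ.* q ℚ.< 0ℚ
      ½q<0 = halve-< (subst (ℚ._< 0ℚ) (sym (double-½ q)) q<0)

    ½^ : ℕ → ℚ
    ½^ zero    = 1ℚ
    ½^ (suc n) = ½ ℚ.* ½^ n

    0<½^ : ∀ n → 0ℚ ℚ.< ½^ n
    0<½^ zero    = 0<1
    0<½^ (suc n) =
      halve-< (subst (0ℚ ℚ.<_) (sym (double-½ (½^ n))) (0<½^ n))

    2^-≤ : ∀ i {x} → x ≤ 1ℝ → 2^- i · x ≤ fromℚ (½^ i)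
    2^-≤ zero    x≤1 = x≤1
    2^-≤ (suc i) x≤1 {q} q∈ =
      halve-< (subst (q ℚ.+ q ℚ.<_) (sym (double-½ (½^ i))) (2^-≤ i x≤1 q∈))

    ∑≤ : ∀ n {f : ℕ → ℝ} → (∀ i → f i ≤ 1ℝ) →
         ∑[ n ] (λ i → 2^- i · f i) ≤ fromℚ (1ℚ ℚ.- ½^ n)
    ∑≤ zero    f≤1 = id
    ∑≤ (suc n) f≤1 (a , b , a∈ , b∈ , refl) =
      subst (a ℚ.+ b ℚ.<_) (telescope n)
        (ℚ.+-mono-< (∑≤ n f≤1 a∈) (2^-≤ (suc n) (f≤1 (suc n)) b∈))
      where
      open +-*-Solver
      rearrange : ∀ h → 1ℚ ℚ.- (h ℚ.+ h) ℚ.+ h ≡ 1ℚ ℚ.- h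
      rearrange = solve 1 (λ h → (con 1ℚ :- (h :+ h)) :+ h := con 1ℚ :- h) refl
      telescope : ∀ n → 1ℚ ℚ.- ½^ n ℚ.+ ½^ (suc n) ≡ 1ℚ ℚ.- ½^ (suc n)
      telescope n = subst (λ h → 1ℚ ℚ.- h ℚ.+ ½^ (suc n) ≡ 1ℚ ℚ.- ½^ (suc n))
                      (double-½ (½^ n)) (rearrange (½^ (suc n)))

  0≤distString : ∀ s t → 0ℝ ≤ distString s t
  0≤distString s t =
    0≤∑ (length s ℕ.⊔ length t)
        (λ i → 0≤2^- i (0≤distε (symbol s i) (symbol t i)))

  distString≤1 : ∀ s t → distString s t ≤ 1ℝ
  distString≤1 s t {q} q∈ =
    ℚ.<-trans (∑≤ n (λ i → distε≤1 (symbol s i) (symbol t i)) q∈)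
      (ℚ.+-monoʳ-< 1ℚ (ℚ.neg-antimono-< (0<½^ n)))
    where n = length s ℕ.⊔ length t

  distToLanguage : List E → Language E → ℝ
  distToLanguage s A with em {P = ∃ λ a → a ∈ A}
  ... | no  _ = 1ℝ
  ... | yes a = inf (λ (b : ∃ λ b → b ∈ A) → distString s (proj₁ b)) a
                  (0ℝ , λ b → 0≤distString s (proj₁ b))

  distToLanguage≤1 : ∀ s A → distToLanguage s A ≤ 1ℝ
  distToLanguage≤1 s A with em {P = ∃ λ a → a ∈ A}
  ... | no  _ = id
  ... | yes a = λ (r , q<r , r∈) →
                  distString≤1 s (proj₁ a) (ℝ.closed (distString s (proj₁ a)) q<r (r∈ a))

  -- sup over a ∈ A of d(a, B)

  excess : Language E → Language E → ℝ
  excess A B with em {P = ∃ λ a → a ∈ A}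
  ... | no  _ = 0ℝ
  ... | yes a = sup (λ (b : ∃ λ b → b ∈ A) → distToLanguage (proj₁ b) B) a
                  (1ℝ , λ b → distToLanguage≤1 (proj₁ b) B)

  -- For A = B = ∅ this is 0 ⊔ 0, which is the value required there.

  distLanguage : Language E → Language E → ℝ
  distLanguage A B = excess A B ⊔ excess B A

------------------------------------------------------------------------
-- Discrete event systems

closure : {E : Set} → Language E → Language E
closure L s = ∃ λ t → s ++ t ∈ L

PrefixClosed : {E : Set} → Language E → Set
PrefixClosed L = closure L ⊆ L

record Automaton (E : Set) : Set₁ where
  field
    Q  : Set
    δ  : Q → E → Maybe Q
    q₀ : Q

  δ* : Q → List E → Maybe Q
  δ* q []      = just q
  δ* q (σ ∷ s) = δ q σ >>= λ q′ → δ* q′ s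

𝓛 : {E : Set} → Automaton E → Language E
𝓛 G s = Is-just (δ* q₀ s)
  where open Automaton G

-- E_c is the complement of Euc.

module Control {E : Set} (G : Automaton E) (Euc : Pred E 0ℓ) where

  record Controllable (K : Language E) : Set where
    field
      ⊆𝓛       : K ⊆ 𝓛 G
      invariant : ∀ {s σ} → s ∈ closure K → σ ∈ Euc →
                  s ∷ʳ σ ∈ 𝓛 G → s ∷ʳ σ ∈ closure K

  -- Is-just is a proposition, so the enabled set depends on the string
  -- only.

  record Supervisor : Set₁ where
    field
      enabled : ∃ (𝓛 G) → Pred E 0ℓ
      Euc⊆    : ∀ s → Euc ⊆ enabled s

  data Generated (S : Supervisor) : Language E where
    empty : [] ∈ Generated S
    step  : ∀ {s σ} → s ∈ Generated S → (s∈G : s ∈ 𝓛 G) → s ∷ʳ σ ∈ 𝓛 G →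
            σ ∈ Supervisor.enabled S (s , s∈G) → s ∷ʳ σ ∈ Generated S

  module Approximate (em : Classical) (d : Metric E) where
    open Distances em d

    _-Controllable_ : ℝ → Language E → Set₁
    λ₀ -Controllable K =
      ∃ λ K̃ → Controllable K̃ × distLanguage K̃ K ≤ λ₀

    module OCP (K : Language E) (λ₀ : ℝ) where

      CEM DEM : Supervisor → Language E
      CEM S = Generated S ∩ K
      DEM S = Generated S ∖ K

      WithinTolerance : Supervisor → Set
      WithinTolerance S = distLanguage (Generated S) K ≤ λ₀

      _ImprovesOn_ : Supervisor → Supervisor → Set
      S′ ImprovesOn S =
        CEM S ⊆ CEM S′ × DEM S′ ⊆ DEM S × (CEM S ⊂ CEM S′ ⊎ DEM S′ ⊂ DEM S)

      ParetoOptimal : Supervisor → Set₁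
      ParetoOptimal S = ¬ ∃ λ S′ → WithinTolerance S′ × S′ ImprovesOn S

      Solution : Supervisor → Set₁
      Solution S = WithinTolerance S × ParetoOptimal S

{-# OPTIONS --safe #-}
-- If K is λ-controllable, the behaviours (languages L(S/G)) within distance
-- λ of K are closed under unions, so there is a largest one, M; it maximises
-- CEM, with value C = M ∩ K. It remains to make DEM minimal while keeping C.
-- Truncating strings does not increase distances, so d(k, A) only depends on
-- the strings of A that are no longer than k. There are finitely many of
-- these, hence the behaviours within distance λ that contain C are closed
-- under intersections of decreasing sequences. As E* is countable, a minimal
-- one below M is reached by discarding the strings one after another. Its
-- supervisor is Pareto optimal: an improvement lies below it and contains C.
module Submission where

open import Data.Empty using (⊥-elim)
open import Data.Fin.Base using (Fin; toℕ)
open import Data.Fin.Properties using (toℕ-injective; toℕ<n)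
open import Data.List.Base
  using (List; []; _∷_; _++_; _∷ʳ_; length; take; drop; map; allFin;
         cartesianProductWith; initLast; _∷ʳ′_)
open import Data.List.Membership.Propositional using () renaming (_∈_ to _∈ˡ_)
open import Data.List.Membership.Propositional.Properties
  using (∈-map⁺; ∈-allFin; ∈-cartesianProductWith⁺)
open import Data.List.Properties
  using (++-assoc; ++-identityʳ; ∷ʳ-injective; length-take; take-all; take++drop≡id)
open import Data.List.Relation.Unary.Any using (here; there)
open import Data.List.Reverse using (Reverse; reverseView; _∶_∶ʳ_)
open import Data.Maybe using (just; nothing; Is-just)
import Data.Maybe.Relation.Unary.Any as Maybe
open import Data.Nat.Base as ℕ using (ℕ; zero; suc; s≤s)
open import Data.Nat.DivMod using (_%_; [m+kn]%n≡m%n; m<n⇒m%n≡m)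
import Data.Nat.Properties as ℕ
open import Data.Product.Base using (∃; _×_; _,_; proj₁; proj₂)
open import Data.Rational.Base as ℚ using (1ℚ)
import Data.Rational.Properties as ℚ
open import Data.Rational.Solver using (module +-*-Solver)
open import Data.Sum.Base using (_⊎_; inj₁; inj₂; [_,_]′)
open import Data.Unit.Base using (tt)
open import Function.Base using (id; _∘_)
open import Function.Bundles using (_⇔_; mk⇔; module Inverse)
open import Function.Definitions using (Injective)
open import Level using (0ℓ)
open import Relation.Binary.PropositionalEquality
  using (_≡_; refl; sym; trans; cong; cong₂; subst)
open import Relation.Nullary.Decidable.Core
  using (Dec; yes; no; True; toWitness; fromWitness; decidable-stable)
open import Relation.Nullary.Negation.Core using (¬_)
open import Relation.Unary
  using (Pred; _∈_; _∉_; _⊆_; _≐_; _∩_; ⋂; Satisfiable)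
open import Defs

-- Minimal members of families closed under decreasing intersections

Decreasing : {X : Set} → (ℕ → Pred X 0ℓ) → Set
Decreasing F = ∀ {m n} → m ℕ.≤ n → F n ⊆ F m

decreasing-from-step : {X : Set} (F : ℕ → Pred X 0ℓ) →
                       (∀ n → F (suc n) ⊆ F n) → Decreasing F
decreasing-from-step F F↓ m≤n = go (ℕ.≤⇒≤′ m≤n)
  where
  go : ∀ {m n} → m ℕ.≤′ n → F n ⊆ F m
  go (ℕ.≤′-reflexive refl) = id
  go (ℕ.≤′-step m≤n)       = go m≤n ∘ F↓ _

module _ (em : Classical) {X : Set} where

  -- An element that drops out of some `F n` stays out, the sequence being decreasing, so the
  -- maximum of finitely many dropping times serves as `N`.
  stabilises : (F : ℕ → Pred X 0ℓ) → Decreasing F → (xs : List X) →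
               ∃ λ N → ∀ {x} → x ∈ˡ xs → x ∈ F N → x ∈ ⋂ ℕ F
  stabilises F F↓ [] = 0 , λ ()
  stabilises F F↓ (x ∷ xs) with stabilises F F↓ xs | em {P = ∃ λ n → x ∉ F n}
  ... | N , h | yes (n , x∉Fn) = N ℕ.⊔ n , λ where
    (here refl)  x∈F → ⊥-elim (x∉Fn (F↓ (ℕ.m≤n⊔m N n) x∈F))
    (there y∈xs) y∈F → h y∈xs (F↓ (ℕ.m≤m⊔n N n) y∈F)
  ... | N , h | no x∈⋂F = N , λ where
    (here refl)  _   n → decidable-stable em λ x∉Fn → x∈⋂F (n , x∉Fn)
    (there y∈xs) y∈F → h y∈xs y∈F

  module _ (code : X → ℕ) (code-injective : Injective _≡_ _≡_ code)
           {ℓ} (𝒫 : Pred (Pred X 0ℓ) ℓ)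
           (⋂-closed : ∀ F → Decreasing F → (∀ n → F n ∈ 𝒫) → ⋂ ℕ F ∈ 𝒫)
           where

    -- The element is quantified over because `n` need not be a code; by injectivity there is at
    -- most one.
    Removal : ℕ → Pred X 0ℓ → Set _
    Removal n A = ∃ λ B → B ∈ 𝒫 × B ⊆ A × ∃ λ x → code x ≡ n × x ∉ B

    prune : ℕ → ∃ 𝒫 → ∃ 𝒫
    prune n (A , A∈𝒫) with em {P = Removal n A}
    ... | yes (B , B∈𝒫 , _) = B , B∈𝒫
    ... | no  _             = A , A∈𝒫

    prune-⊆ : ∀ n A → proj₁ (prune n A) ⊆ proj₁ A
    prune-⊆ n (A , _) with em {P = Removal n A}
    ... | yes (_ , _ , B⊆A , _) = B⊆A
    ... | no  _                 = id

    prune-removes : ∀ {B x} A → B ∈ 𝒫 → B ⊆ proj₁ A → x ∉ B →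
                    x ∉ proj₁ (prune (code x) A)
    prune-removes {B} {x} (A , _) B∈𝒫 B⊆A x∉B x∈A
      with em {P = Removal (code x) A}
    ... | yes (B′ , _ , _ , y , eq , y∉B′) =
            y∉B′ (subst (_∈ B′) (sym (code-injective eq)) x∈A)
    ... | no  none = none (B , B∈𝒫 , B⊆A , x , refl , x∉B)

    -- If a member of `𝒫` below the intersection omitted `x`, it would lie below stage `code x`, so
    -- that stage would have been pruned of `x` already.
    minimal-below : ∀ {A} → A ∈ 𝒫 →
                    ∃ λ B → B ∈ 𝒫 × B ⊆ A × (∀ {C} → C ∈ 𝒫 → C ⊆ B → B ⊆ C)
    minimal-below {A} A∈𝒫 =
      ⋂ ℕ F
      , ⋂-closed F (decreasing-from-step F λ n → prune-⊆ n (stage n)) (proj₂ ∘ stage)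
      , (λ x∈⋂F → x∈⋂F 0)
      , λ C∈𝒫 C⊆⋂F {x} x∈⋂F → decidable-stable em λ x∉C →
          prune-removes (stage (code x)) C∈𝒫 (λ y∈C → C⊆⋂F y∈C (code x)) x∉C
            (x∈⋂F (suc (code x)))
      where
      stage : ℕ → ∃ 𝒫
      stage zero    = A , A∈𝒫
      stage (suc n) = prune n (stage n)
      F : ℕ → Pred X 0ℓ
      F = proj₁ ∘ stage

-- Strings over a finite alphabet

module Words {E : Set} (finite : Finite E) where
  private
    k = proj₁ finite
    module I = Inverse (proj₂ finite)

  digit-unique : ∀ {n} (x y : Fin n) c d →
                 toℕ x ℕ.+ c ℕ.* n ≡ toℕ y ℕ.+ d ℕ.* n → x ≡ y × c ≡ d
  digit-unique {n@(suc _)} x y c d eq with toℕ-injective x≡y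
    where
    residue : ∀ (z : Fin n) e → (toℕ z ℕ.+ e ℕ.* n) % n ≡ toℕ z
    residue z e = trans ([m+kn]%n≡m%n (toℕ z) e n) (m<n⇒m%n≡m (toℕ<n z))
    x≡y : toℕ x ≡ toℕ y
    x≡y = trans (sym (residue x c)) (trans (cong (_% n) eq) (residue y d))
  ... | refl = refl , ℕ.*-cancelʳ-≡ c d n (ℕ.+-cancelˡ-≡ (toℕ x) _ _ eq)

  -- Bijective base-`k` numeration: digits 1 to `k`, least significant first.
  code : List E → ℕ
  code []      = 0
  code (a ∷ s) = suc (toℕ (I.to a) ℕ.+ code s ℕ.* k)

  code-injective : Injective _≡_ _≡_ code
  code-injective {[]}    {[]}    _  = refl
  code-injective {a ∷ s} {b ∷ t} eq =
    let a≡b , s≡t = digit-unique (I.to a) (I.to b) (code s) (code t) (ℕ.suc-injective eq)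
    in cong₂ _∷_ (to-injective a≡b) (code-injective s≡t)
    where
    to-injective : ∀ {a b} → I.to a ≡ I.to b → a ≡ b
    to-injective eq = trans (sym (I.strictlyInverseʳ _))
                        (trans (cong I.from eq) (I.strictlyInverseʳ _))

  words≤ : ℕ → List (List E)
  words≤ zero    = [] ∷ []
  words≤ (suc n) = [] ∷ cartesianProductWith _∷_ (map I.from (allFin k)) (words≤ n)

  ∈-words≤ : ∀ {n} s → length s ℕ.≤ n → s ∈ˡ words≤ n
  ∈-words≤ {zero}  []      _         = here refl
  ∈-words≤ {suc n} []      _         = here refl
  ∈-words≤ {suc n} (a ∷ s) (s≤s s≤n) = there
    (∈-cartesianProductWith⁺ _∷_
      (subst (_∈ˡ map I.from (allFin k)) (I.strictlyInverseʳ a)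
        (∈-map⁺ I.from (∈-allFin (I.to a))))
      (∈-words≤ s s≤n))

-- Sums of reals

-- The cut of `y` is only known to contain the negative rationals, so roundedness of `x` first
-- supplies some `r` above `q`, making `q - r` negative.
≤-+-nonNegativeʳ : ∀ x y → 0ℝ ≤ y → x ≤ x + y
≤-+-nonNegativeʳ x y 0≤y {q} q∈x =
  let r , q<r , r∈x = ℝ.rounded x q∈x in
  r , q ℚ.- r , r∈x
  , 0≤y (subst (q ℚ.- r ℚ.<_) (ℚ.+-inverseʳ r) (ℚ.+-monoˡ-< (ℚ.- r) q<r))
  , difference q r
  where
  open +-*-Solver
  difference : ∀ q r → q ≡ r ℚ.+ (q ℚ.- r)
  difference = solve 2 (λ q r → q := r :+ (q :- r)) refl

2^-mono : ∀ i {x y} → x ≤ y → 2^- i · x ≤ 2^- i · y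
2^-mono zero    x≤y = x≤y
2^-mono (suc i) x≤y q∈ = 2^-mono i x≤y q∈

0≤2^- : ∀ i {x} → 0ℝ ≤ x → 0ℝ ≤ 2^- i · x
0≤2^- zero    0≤x = 0≤x
0≤2^- (suc i) 0≤x q<0 = 0≤2^- i 0≤x (ℚ.+-mono-< q<0 q<0)

∑-mono : ∀ n {f g} → (∀ i → f i ≤ g i) → ∑[ n ] f ≤ ∑[ n ] g
∑-mono zero    f≤g = id
∑-mono (suc n) f≤g (a , b , a∈ , b∈ , eq) = a , b , ∑-mono n f≤g a∈ , f≤g (suc n) b∈ , eq

∑-extend : ∀ {m n f} → (∀ i → 0ℝ ≤ f i) → m ℕ.≤ n → ∑[ m ] f ≤ ∑[ n ] f
∑-extend {f = f} 0≤f m≤n = go (ℕ.≤⇒≤′ m≤n)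
  where
  go : ∀ {m n} → m ℕ.≤′ n → ∑[ m ] f ≤ ∑[ n ] f
  go (ℕ.≤′-reflexive refl)    = id
  go (ℕ.≤′-step {n = n} m≤n) q∈ = ≤-+-nonNegativeʳ (∑[ n ] f) (f (suc n)) (0≤f (suc n)) (go m≤n q∈)

-- Distances between strings and languages

take-∈ : {E : Set} (A : Language E) → PrefixClosed A → ∀ n {s} → s ∈ A → take n s ∈ A
take-∈ A closed n {s} s∈A =
  closed (drop n s , subst (_∈ A) (sym (take++drop≡id n s)) s∈A)

take-length-++ : {E : Set} (s t : List E) → take (length s) (s ++ t) ≡ s
take-length-++ []      t = refl
take-length-++ (a ∷ s) t = cong (a ∷_) (take-length-++ s t)

module LanguageDistances (em : Classical) {E : Set} (d : Metric E) where
  open Metric d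
  open Distances em d

  0≤distε : ∀ u v → 0ℝ ≤ distε u v
  0≤distε nothing  nothing  = id
  0≤distε (just a) (just b) = nonNegative {a} {b}
  0≤distε (just _) nothing  = λ q<0 → ℚ.<-trans q<0 (ℚ.positive⁻¹ 1ℚ)
  0≤distε nothing  (just _) = λ q<0 → ℚ.<-trans q<0 (ℚ.positive⁻¹ 1ℚ)

  -- The alternative depends on `n` and `i` alone, so that two strings truncated together fall into
  -- the same case.
  symbol-take : ∀ n i → (∀ s → symbol (take n s) i ≡ symbol s i) ⊎
                        (∀ s → symbol (take n s) i ≡ nothing)
  symbol-take zero    i             = inj₂ λ _ → refl
  symbol-take (suc n) zero          = inj₁ λ { [] → refl ; (_ ∷ _) → refl }
  symbol-take (suc n) (suc zero)    = inj₁ λ { [] → refl ; (_ ∷ _) → refl }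
  symbol-take (suc n) (suc (suc i)) with symbol-take n (suc i)
  ... | inj₁ same = inj₁ λ { [] → refl ; (_ ∷ s) → same s }
  ... | inj₂ none = inj₂ λ { [] → refl ; (_ ∷ s) → none s }

  -- Each summand is kept or becomes the distance 0 from ε to ε, and the summands lost at the end
  -- are nonnegative.
  distString-take : ∀ n s t → distString (take n s) (take n t) ≤ distString s t
  distString-take n s t q∈ =
    ∑-extend (λ i → 0≤2^- i (0≤distε (symbol s i) (symbol t i))) shorter
      (∑-mono (length (take n s) ℕ.⊔ length (take n t)) (λ i → 2^-mono i (symbolwise i)) q∈)
    where
    symbolwise : ∀ i → distε (symbol (take n s) i) (symbol (take n t) i) ≤
                       distε (symbol s i) (symbol t i)
    symbolwise i with symbol-take n i
    ... | inj₁ same rewrite same s | same t = id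
    ... | inj₂ none rewrite none s | none t = 0≤distε (symbol s i) (symbol t i)
    length-take≤ : ∀ u → length (take n u) ℕ.≤ length u
    length-take≤ u = subst (ℕ._≤ length u) (sym (length-take n u)) (ℕ.m⊓n≤n n (length u))
    shorter : length (take n s) ℕ.⊔ length (take n t) ℕ.≤ length s ℕ.⊔ length t
    shorter = ℕ.⊔-mono-≤ (length-take≤ s) (length-take≤ t)

  distToLanguage-dominated :
    ∀ s t A B → (∀ {b} → b ∈ B → ∃ λ a → a ∈ A × distString s a ≤ distString t b) →
    distToLanguage s A ≤ distToLanguage t B
  distToLanguage-dominated s t A B h
    with em {P = ∃ λ b → b ∈ B}
  -- The right-hand side is the default value 1, which bounds every distance.
  ... | no  _         = distToLanguage≤1 s A
  ... | yes (b , b∈B) with em {P = ∃ λ a → a ∈ A}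
  ...   | no  A-empty = ⊥-elim (A-empty (proj₁ (h b∈B) , proj₁ (proj₂ (h b∈B))))
  ...   | yes _       = λ (r , q<r , r∈) →
    r , q<r , λ (b , b∈B) → let a , a∈A , a≤b = h b∈B in a≤b (r∈ (a , a∈A))

  distToLanguage-anti : ∀ s A B → B ⊆ A → distToLanguage s A ≤ distToLanguage s B
  distToLanguage-anti s A B B⊆A = distToLanguage-dominated s s A B λ b∈B → _ , B⊆A b∈B , id

  distToLanguage-prefix : ∀ s t K → PrefixClosed K →
                          distToLanguage s K ≤ distToLanguage (s ++ t) K
  distToLanguage-prefix s t K closed = distToLanguage-dominated s (s ++ t) K K λ {b} b∈K →
    take n b , take-∈ K closed n b∈K ,
    subst (λ u → distString u (take n b) ≤ distString (s ++ t) b)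
      (take-length-++ s t) (distString-take n (s ++ t) b)
    where n = length s

  -- Cutting a competitor `b` to the length of `s` leaves `s` itself unchanged, stays in `B` and
  -- brings `b` no further away.
  distToLanguage-short : ∀ s A B → PrefixClosed B →
                         (∀ {b} → length b ℕ.≤ length s → b ∈ B → b ∈ A) →
                         distToLanguage s A ≤ distToLanguage s B
  distToLanguage-short s A B closed short = distToLanguage-dominated s s A B λ {b} b∈B →
    take n b
    , short (subst (ℕ._≤ n) (sym (length-take n b)) (ℕ.m⊓n≤m n (length b)))
        (take-∈ B closed n b∈B)
    , subst (λ u → distString u (take n b) ≤ distString s b)
        (take-all n s ℕ.≤-refl) (distString-take n s b)
    where n = length s

  infix 4 _Within_Of_
  -- One half of a Hausdorff bound, freed from the case distinction on `A` being empty.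
  _Within_Of_ : Language E → ℝ → Language E → Set
  A Within x Of B = ∀ {s} → s ∈ A → distToLanguage s B ≤ x

  excess≤⇒within : ∀ A B x → excess A B ≤ x → A Within x Of B
  excess≤⇒within A B x h {s} s∈A with em {P = ∃ λ a → a ∈ A}
  ... | no  A-empty = ⊥-elim (A-empty (s , s∈A))
  ... | yes _       = λ q∈ → h ((s , s∈A) , q∈)

  within⇒excess≤ : ∀ A B x → 0ℝ ≤ x → A Within x Of B → excess A B ≤ x
  within⇒excess≤ A B x 0≤x h with em {P = ∃ λ a → a ∈ A}
  ... | no  _ = 0≤x
  ... | yes _ = λ ((s , s∈A) , q∈) → h s∈A q∈

  distLanguage≤⇒within : ∀ A B x → distLanguage A B ≤ x →
                         A Within x Of B × B Within x Of A
  distLanguage≤⇒within A B x h =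
    excess≤⇒within A B x (h ∘ inj₁) , excess≤⇒within B A x (h ∘ inj₂)

  within⇒distLanguage≤ : ∀ A B x → 0ℝ ≤ x → A Within x Of B → B Within x Of A →
                         distLanguage A B ≤ x
  within⇒distLanguage≤ A B x 0≤x h h′ =
    [ within⇒excess≤ A B x 0≤x h , within⇒excess≤ B A x 0≤x h′ ]′

  within-empty : ∀ A B x → ¬ Satisfiable B → Satisfiable A → A Within x Of B → 1ℝ ≤ x
  within-empty A B x B-empty (a , a∈A) h with em {P = ∃ λ b → b ∈ B} | h a∈A
  ... | no  _ | 1≤x = 1≤x
  ... | yes b | _   = ⊥-elim (B-empty b)

-- Behaviours of supervised automata

⊆-closure : {E : Set} (A : Language E) → A ⊆ closure A
⊆-closure A {s} s∈A = [] , subst (_∈ A) (sym (++-identityʳ s)) s∈A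

closure-prefixClosed : {E : Set} (A : Language E) → PrefixClosed (closure A)
closure-prefixClosed A {s} (t , u , stu∈A) = t ++ u , subst (_∈ A) (++-assoc s t u) stu∈A

𝓛-prefixClosed : {E : Set} (G : Automaton E) → PrefixClosed (𝓛 G)
𝓛-prefixClosed G {s} (t , st∈) = go q₀ s st∈
  where
  open Automaton G
  go : ∀ q s → Is-just (δ* q (s ++ t)) → Is-just (δ* q s)
  go q []      _ = Maybe.just tt
  go q (σ ∷ s) h with δ q σ
  ... | just q′ = go q′ s h

module Behaviours {E : Set} (G : Automaton E) (Euc : Pred E 0ℓ) where
  open Control G Euc

  -- These are exactly the languages generated under supervision; prefix closedness lets invariance
  -- speak of `M` instead of its closure.
  record Behaviour (M : Language E) : Set where
    field
      nonempty     : [] ∈ M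
      prefixClosed : PrefixClosed M
      ⊆𝓛           : M ⊆ 𝓛 G
      invariant    : ∀ {s σ} → s ∈ M → σ ∈ Euc → s ∷ʳ σ ∈ 𝓛 G → s ∷ʳ σ ∈ M

  open Behaviour public

  behaviour-controllable : ∀ {M} → Behaviour M → Controllable M
  behaviour-controllable {M} b = record
    { ⊆𝓛       = ⊆𝓛 b
    ; invariant = λ s∈M̄ σ∈Euc sσ∈G →
        ⊆-closure M (invariant b (prefixClosed b s∈M̄) σ∈Euc sσ∈G)
    }

  closure-behaviour : ∀ {M} → Controllable M → Satisfiable M → Behaviour (closure M)
  closure-behaviour {M} c (s , s∈M) = record
    { nonempty     = s , s∈M
    ; prefixClosed = closure-prefixClosed M
    ; ⊆𝓛           = λ {s} (t , st∈M) → 𝓛-prefixClosed G {s} (t , c.⊆𝓛 st∈M)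
    ; invariant    = c.invariant
    }
    where module c = Controllable c

  generated-⊆𝓛 : ∀ S → Generated S ⊆ 𝓛 G
  generated-⊆𝓛 S empty             = Maybe.just tt
  generated-⊆𝓛 S (step _ _ sσ∈G _) = sσ∈G

  generated-prefixClosed : ∀ S → PrefixClosed (Generated S)
  generated-prefixClosed S {s} (t , st∈) = go st∈ s t refl
    where
    -- The equation replaces the index `s ++ t`, which does not unify with a snoc; each last letter
    -- of `t` undoes one `step`.
    go : ∀ {u} → u ∈ Generated S → ∀ s t → u ≡ s ++ t → s ∈ Generated S
    go u∈ s t eq with initLast t
    go u∈ s _ eq | [] = subst (_∈ Generated S) (trans eq (++-identityʳ s)) u∈
    -- The equation is contradictory here, but the goal is immediate anyway.
    go empty [] _ eq | _ ∷ʳ′ _ = empty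
    go (step {u} u∈ _ _ _) s _ eq | t ∷ʳ′ σ =
      go u∈ s t (proj₁ (∷ʳ-injective u (s ++ t)
        (trans eq (sym (++-assoc s t (σ ∷ []))))))

  generated-behaviour : ∀ S → Behaviour (Generated S)
  generated-behaviour S = record
    { nonempty     = empty
    ; prefixClosed = generated-prefixClosed S
    ; ⊆𝓛           = generated-⊆𝓛 S
    ; invariant    = λ s∈ σ∈Euc sσ∈G →
        step s∈ (generated-⊆𝓛 S s∈) sσ∈G (Supervisor.Euc⊆ S _ σ∈Euc)
    }

  supervisorFor : Language E → Supervisor
  supervisorFor M = record
    { enabled = λ (s , _) σ → σ ∈ Euc ⊎ s ∷ʳ σ ∈ M
    ; Euc⊆    = λ _ → inj₁
    }

  -- Invariance keeps the always enabled uncontrollable events inside `M`; conversely, every prefix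
  -- of a string of `M` is in `M`, so the string is generated letter by letter.
  generated-supervisorFor : ∀ {M} → Behaviour M → Generated (supervisorFor M) ≐ M
  generated-supervisorFor {M} b = sound , λ {s} → complete (reverseView s)
    where
    sound : Generated (supervisorFor M) ⊆ M
    sound empty                           = nonempty b
    sound (step s∈ _ sσ∈G (inj₁ σ∈Euc)) = invariant b (sound s∈) σ∈Euc sσ∈G
    sound (step _  _ _    (inj₂ sσ∈M))   = sσ∈M
    complete : ∀ {s} → Reverse s → s ∈ M → s ∈ Generated (supervisorFor M)
    complete Reverse.[]    _    = empty
    complete (s ∶ rs ∶ʳ σ) sσ∈M =
      step (complete rs s∈M) (⊆𝓛 b s∈M) (⊆𝓛 b sσ∈M) (inj₂ sσ∈M)
      where
      s∈M : s ∈ M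
      s∈M = prefixClosed b (σ ∷ [] , sσ∈M)

-- Feasible languages and the construction of an optimal supervisor

module Optimisation
  (em : Classical) {E : Set} (finite : Finite E)
  (G : Automaton E) (Euc : Pred E 0ℓ) (d : Metric E)
  (λ₀ : ℝ) (0≤λ₀ : 0ℝ ≤ λ₀)
  (K : Language E) (K-nonempty : Satisfiable K) (K-closed : PrefixClosed K)
  where

  open Control G Euc
  open Approximate em d
  open OCP K λ₀
  open Behaviours G Euc
  open Distances em d
  open LanguageDistances em d
  open Words finite

  record Feasible (M : Language E) : Set where
    field
      behaviour : Behaviour M
      sound     : M Within λ₀ Of K
      covering  : K Within λ₀ Of M

  open Feasible

  feasible-generated : ∀ S → WithinTolerance S → Feasible (Generated S)
  feasible-generated S h =
    let M-within , K-within = distLanguage≤⇒within (Generated S) K λ₀ h in record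
    { behaviour = generated-behaviour S ; sound = M-within ; covering = K-within }

  -- A prefix is no further from the prefix closed `K` than the whole string, and enlarging `K̃`
  -- only lowers distances to it.
  closure-feasible : ∀ {K̃} → Controllable K̃ → Satisfiable K̃ →
                     distLanguage K̃ K ≤ λ₀ → Feasible (closure K̃)
  closure-feasible {K̃} c K̃-nonempty h =
    let K̃-within , K-within = distLanguage≤⇒within K̃ K λ₀ h in record
    { behaviour = closure-behaviour c K̃-nonempty
    ; sound     = λ {s} (t , st∈K̃) q∈ →
                    K̃-within st∈K̃ (distToLanguage-prefix s t K K-closed q∈)
    ; covering  = λ {k} k∈K q∈ →
                    K-within k∈K (distToLanguage-anti k (closure K̃) K̃ (⊆-closure K̃) q∈)
    }

  behaviour-feasible : ∀ {M} → 1ℝ ≤ λ₀ → Behaviour M → Feasible M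
  behaviour-feasible {M} 1≤λ₀ b = record
    { behaviour = b
    ; sound     = λ {s} _ q∈ → 1≤λ₀ (distToLanguage≤1 s K q∈)
    ; covering  = λ {s} _ q∈ → 1≤λ₀ (distToLanguage≤1 s M q∈)
    }

  some-feasible : λ₀ -Controllable K → ∃ Feasible
  some-feasible (K̃ , c , h) = choose em
    where
    choose : Dec (Satisfiable K̃) → ∃ Feasible
    choose (yes K̃-nonempty) = closure K̃ , closure-feasible c K̃-nonempty h
    -- d(∅, K) = 1, so that λ₀ = 1 and every behaviour is feasible.
    choose (no K̃-empty) = Generated S , behaviour-feasible
      (within-empty K K̃ λ₀ K̃-empty K-nonempty (proj₂ (distLanguage≤⇒within K̃ K λ₀ h)))
      (generated-behaviour S)
      where
      S : Supervisor
      S = supervisorFor (𝓛 G)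

  -- The union of all feasible languages; excluded middle brings the
  -- quantification over languages back into Set.
  largest : Language E
  largest s = True (em {P = ∃ λ M → Feasible M × s ∈ M})

  ⊆-largest : ∀ {M} → Feasible M → M ⊆ largest
  ⊆-largest {M} f s∈M = fromWitness (M , f , s∈M)

  -- Soundness and the closure conditions start from one string and are inherited from a member
  -- containing it; `M₀` alone ensures ε and the covering of `K`.
  largest-feasible : ∃ Feasible → Feasible largest
  largest-feasible (M₀ , f₀) = record
    { behaviour = record
      { nonempty     = ⊆-largest f₀ (nonempty (behaviour f₀))
      ; prefixClosed = λ (t , st∈) → let M , f , st∈M = toWitness st∈ in
                         ⊆-largest f (prefixClosed (behaviour f) (t , st∈M))
      ; ⊆𝓛           = λ s∈ → let M , f , s∈M = toWitness s∈ in ⊆𝓛 (behaviour f) s∈M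
      ; invariant    = λ s∈ σ∈Euc sσ∈G → let M , f , s∈M = toWitness s∈ in
                         ⊆-largest f (invariant (behaviour f) s∈M σ∈Euc sσ∈G)
      }
    ; sound    = λ s∈ → let M , f , s∈M = toWitness s∈ in sound f s∈M
    ; covering = λ {k} k∈K q∈ →
                   covering f₀ k∈K (distToLanguage-anti k largest M₀ (⊆-largest f₀) q∈)
    }

  ⋂-feasible : ∀ F → Decreasing F → (∀ n → Feasible (F n)) → Feasible (⋂ ℕ F)
  ⋂-feasible F F↓ f = record
    { behaviour = record
      { nonempty     = λ n → nonempty (b n)
      ; prefixClosed = λ (t , st∈) n → prefixClosed (b n) (t , st∈ n)
      ; ⊆𝓛           = λ s∈ → ⊆𝓛 (b 0) (s∈ 0)
      ; invariant    = λ s∈ σ∈Euc sσ∈G n → invariant (b n) (s∈ n) σ∈Euc sσ∈G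
      }
    ; sound    = λ s∈ → sound (f 0) (s∈ 0)
    ; covering = λ {k} k∈K q∈ →
        -- Only words no longer than `k` affect its distance, and from stage `N` on none of these is
        -- lost.
        let N , stable = stabilises em F F↓ (words≤ (length k)) in
        covering (f N) k∈K
          (distToLanguage-short k (⋂ ℕ F) (F N) (prefixClosed (b N))
            (λ {w} w≤k → stable (∈-words≤ w w≤k)) q∈)
    }
    where
    b : ∀ n → Behaviour (F n)
    b n = behaviour (f n)

  -- Feasible languages lie inside `largest`, so these are the ones whose intersection with `K` is
  -- the greatest possible.
  Keeping : Pred (Language E) 0ℓ
  Keeping M = Feasible M × largest ∩ K ⊆ M

  ⋂-keeping : ∀ F → Decreasing F → (∀ n → F n ∈ Keeping) → ⋂ ℕ F ∈ Keeping
  ⋂-keeping F F↓ h = ⋂-feasible F F↓ (proj₁ ∘ h) , λ s∈ n → proj₂ (h n) s∈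

  -- The language of an improving `S′` lies inside `largest`, so CEM cannot grow; it then lies
  -- inside `M` and is again in `Keeping`, so by minimality DEM cannot shrink.
  supervisorFor-optimal :
    ∀ {M} → M ∈ Keeping → (∀ {M′} → M′ ∈ Keeping → M′ ⊆ M → M ⊆ M′) →
    Solution (supervisorFor M)
  supervisorFor-optimal {M} (f , keeps) minimal = within , pareto
    where
    S = supervisorFor M
    S⊆M : Generated S ⊆ M
    S⊆M = proj₁ (generated-supervisorFor (behaviour f))
    M⊆S : M ⊆ Generated S
    M⊆S = proj₂ (generated-supervisorFor (behaviour f))

    within : WithinTolerance S
    within = within⇒distLanguage≤ (Generated S) K λ₀ 0≤λ₀ (λ s∈ → sound f (S⊆M s∈))
      (λ {k} k∈K q∈ → covering f k∈K (distToLanguage-anti k (Generated S) M M⊆S q∈))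

    pareto : ParetoOptimal S
    pareto (S′ , within′ , CEM⊆ , DEM⊆ , strict) =
      [ (λ (_ , CEM⊉) → CEM⊉ CEM′⊆CEM) , (λ (_ , DEM⊉) → DEM⊉ DEM⊆DEM′) ]′ strict
      where
      f′ : Feasible (Generated S′)
      f′ = feasible-generated S′ within′
      CEM′⊆CEM : CEM S′ ⊆ CEM S
      CEM′⊆CEM (s∈ , s∈K) = M⊆S (keeps (⊆-largest f′ s∈ , s∈K)) , s∈K
      S′⊆M : Generated S′ ⊆ M
      S′⊆M {s} s∈ with em {P = s ∈ K}
      ... | yes s∈K = S⊆M (proj₁ (CEM′⊆CEM (s∈ , s∈K)))
      ... | no  s∉K = S⊆M (proj₁ (DEM⊆ (s∈ , s∉K)))
      keeps′ : largest ∩ K ⊆ Generated S′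
      keeps′ s∈@(_ , s∈K) = proj₁ (CEM⊆ (M⊆S (keeps s∈) , s∈K))
      DEM⊆DEM′ : DEM S ⊆ DEM S′
      DEM⊆DEM′ (s∈ , s∉K) = minimal (f′ , keeps′) S′⊆M (S⊆M s∈) , s∉K

  solution : λ₀ -Controllable K → ∃ Solution
  solution h =
    let M , M∈ , _ , minimal =
          minimal-below em code code-injective Keeping ⋂-keeping
            (largest-feasible (some-feasible h) , proj₁)
    in supervisorFor M , supervisorFor-optimal M∈ minimal

theorem5 : (em : Classical) {E : Set} → Finite E →
    (G : Automaton E) (Euc : Pred E 0ℓ) (d : Metric E)
    (λ₀ : ℝ) → 0ℝ ≤ λ₀ → λ₀ ≤ 1ℝ →
    (K : Language E) → K ⊆ 𝓛 G → Satisfiable K → PrefixClosed K →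
    let open Control G Euc
        open Approximate em d
    in (∃ λ S → OCP.Solution K λ₀ S) ⇔ λ₀ -Controllable K
theorem5 em finite G Euc d λ₀ 0≤λ₀ _ K _ K-nonempty K-closed = mk⇔
  -- The language of the solution is itself the controllable approximation.
  (λ (S , within , _) →
    Control.Generated G Euc S
    , Behaviours.behaviour-controllable G Euc (Behaviours.generated-behaviour G Euc S)
    , within)
  (Optimisation.solution em finite G Euc d λ₀ 0≤λ₀ K K-nonempty K-closed)
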